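{- For every integer $n\geq 0$, $c_{1}(n)\equiv 1 \pmod 2$ if and only if $n=j(j+1)/2$ for some integer $j\geq 0$.
   Context: A partition of $n$ is a finite non-increasing sequence of positive integers (its parts) summing to $n$; the multiplicity of a part is the number of times it occurs, and a part is "repeated" if it occurs at least twice. Let $c_{1}(n)$ be the number of partitions of $n$ in which either (a) all parts are distinct, or (b) there is an odd repeated part $2j-1$ (with $j\ge 1$) such that every positive integer less than $2j-1$ appears as a repeated part, and every part greater than $2j$ is distinct (appears at most once). -}

module Defs where

open import Data.Bool.Base using (Bool; true; false; _∧_; _∨_; not)
open import Data.Nat.Base using (ℕ; zero; suc; _+_; _*_; _∸_; _≡ᵇ_; _≤ᵇ_; _<ᵇ_)
open import Data.List.Base using (List; []; _∷_; map; concat; concatMap; applyUpTo; upTo; length; filterᵇ)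
open import Data.Bool.ListAction using (all; any)
open import Data.Nat.ListAction using (sum)

listsOf : ℕ → ℕ → List (List ℕ)
listsOf zero    n = [] ∷ []
listsOf (suc k) n = concatMap (λ a → map (a ∷_) (listsOf k n)) (applyUpTo suc n)

-- all lists of length ≤ n with entries in {1, ..., n}  (no duplicates:
-- lists of different lengths are different); every partition of n is among them
candidates : ℕ → List (List ℕ)
candidates n = concatMap (λ k → listsOf k n) (applyUpTo (λ i → i) (suc n))

nonIncreasing : List ℕ → Bool
nonIncreasing []           = true
nonIncreasing (a ∷ [])     = true
nonIncreasing (a ∷ b ∷ l)  = (b ≤ᵇ a) ∧ nonIncreasing (b ∷ l)

positive : List ℕ → Bool
positive = all (λ a → 1 ≤ᵇ a)

isPartitionOf : ℕ → List ℕ → Bool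
isPartitionOf n λs = positive λs ∧ nonIncreasing λs ∧ (sum λs ≡ᵇ n)

partitions : ℕ → List (List ℕ)
partitions n = filterᵇ (isPartitionOf n) (candidates n)

mult : ℕ → List ℕ → ℕ
mult k λs = length (filterᵇ (λ a → a ≡ᵇ k) λs)

allDistinct : List ℕ → Bool
allDistinct λs = all (λ a → mult a λs ≤ᵇ 1) λs

condB : ℕ → List ℕ → Bool
condB j λs =
  (2 ≤ᵇ mult (2 * j ∸ 1) λs)
  ∧ all (λ i → 2 ≤ᵇ mult i λs) (applyUpTo suc (2 * j ∸ 2))
  ∧ all (λ a → (a ≤ᵇ 2 * j) ∨ (mult a λs ≤ᵇ 1)) λs

-- there is some j ≥ 1 with condB j; such j has 2j-1 a part, so 2j-1 ≤ sum λs,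
-- hence j ranges over 1 .. sum λs without loss
existsB : List ℕ → Bool
existsB λs = any (λ j → condB j λs) (applyUpTo suc (sum λs))

c₁cond : List ℕ → Bool
c₁cond λs = allDistinct λs ∨ existsB λs

c₁ : ℕ → ℕ
c₁ n = length (filterᵇ c₁cond (partitions n))

{-# OPTIONS --safe #-}
-- A partition is counted exactly when its repeated parts form an initial segment {1,…,v}.
-- Writing U_v = q^(v(v+1)) / (q;q)_v for the partitions with parts 1,…,v, each repeated, the
-- generating function is Σ_v U_v ∏_{i>v} (1 + q^i).  Over 𝔽₂, put
--   Y_r = Σ_v q^(vr) U_v ∏_{i>v+r} (1 + q^i),   D_r = Σ_v q^(vr) U_v ∏_{i>v+r+1} (1 + q^i).
-- Splitting off the factor 1 + q^(v+r+1) gives D_r = Y_r + q^(r+1) Y_{r+1}; cancelling 1 + q^v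
-- against the last denominator of U_v (signs do not matter mod 2) gives
-- D_r = Y_{r+1} + q^(r+2) Y_{r+2} = D_{r+1}.  Since D_r → 1, all D_r equal 1, so
-- Y_r = 1 + q^(r+1) Y_{r+1}, and unfolding Y_0 yields Σ_j q^(j(j+1)/2).
module Submission where

open import Defs
open import Data.Nat.Base using (ℕ; suc; _*_; _/_; _%_)
open import Data.Product using (∃-syntax)
open import Relation.Binary.PropositionalEquality using (_≡_)
open import Function.Bundles using (_⇔_)

open import Algebra.Bundles using (CommutativeMonoid)
import Algebra.Properties.CommutativeSemigroup as CommutativeSemigroupProperties
open import Data.Bool.Base using (Bool; true; false; not; _xor_; _∨_; T)
open import Data.Bool.ListAction using (all)
open import Data.Bool.Properties
  using (xor-same; xor-assoc; xor-comm; xor-identityʳ; not-involutive; T-∧; T-∨)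
open import Data.List.Base using (List; []; _∷_; _++_; map; length; filterᵇ; concatMap; applyUpTo)
open import Data.List.Membership.Propositional using (_∈_; lose; find)
open import Data.List.Membership.Propositional.Properties
  using (∈-map⁺; ∈-map⁻; ∈-++⁺ˡ; ∈-++⁺ʳ; ∈-++⁻; ∈-concatMap⁺; ∈-concatMap⁻;
         ∈-applyUpTo⁺; ∈-applyUpTo⁻; ∈-filter⁺; ∈-filter⁻)
open import Data.List.Membership.Propositional.Properties.WithK using (unique∧set⇒bag)
open import Data.List.Properties using (∷-injectiveˡ; ∷-injectiveʳ)
open import Data.List.Relation.Binary.BagAndSetEquality using (∼bag⇒↭)
open import Data.List.Relation.Binary.Permutation.Propositional.Properties using (↭-length)
open import Data.List.Relation.Unary.All as All using (All; []; _∷_)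
import Data.List.Relation.Unary.All.Properties as All
import Data.List.Relation.Unary.AllPairs as AllPairs
import Data.List.Relation.Unary.AllPairs.Properties as AllPairs
open import Data.List.Relation.Unary.Any using (here; there)
import Data.List.Relation.Unary.Any.Properties as Any
open import Data.List.Relation.Unary.Unique.Propositional using (Unique; []; _∷_)
import Data.List.Relation.Unary.Unique.Propositional.Properties as Unique
open import Data.Nat.Base using (zero; _+_; _∸_; _≤_; _<_; z≤n; s≤s; _≡ᵇ_; _≤ᵇ_)
open import Data.Nat.DivMod using (m*n/n≡m)
open import Data.Nat.ListAction using (sum)
open import Data.Nat.Properties
open import Data.Nat.Tactic.RingSolver using (solve-∀)
open import Data.Product using (_×_; _,_; proj₁; proj₂)
open import Data.Sum.Base using (_⊎_; inj₁; inj₂; [_,_]′)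
open import Function.Base using (_∘_; id)
open import Function.Bundles using (mk⇔; Equivalence)
open import Level using (0ℓ)
open import Relation.Binary.PropositionalEquality using (_≢_; refl; sym; trans; cong; cong₂; subst)
import Relation.Binary.Reasoning.Setoid as SetoidReasoning
open import Relation.Nullary using (yes; no; ¬_; contradiction)
open import Relation.Nullary.Decidable.Core using (T?)

open Equivalence using (to; from)

private variable
  A B : Set
  b i k m n : ℕ
  l : List ℕ
  xs : List (List ℕ)

-- Power series over 𝔽₂

Series : Set
Series = ℕ → Bool

infixl 6 _⊕_

_⊕_ : Series → Series → Series
(f ⊕ g) n = f n xor g n

𝟘 : Series
𝟘 _ = false

𝟙 : Series
𝟙 zero    = true
𝟙 (suc _) = false

-- Multiplication by q^a; since addition is `_xor_`, `mul1+ k` below is multiplication by 1 + q^k,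
-- which is also 1 - q^k.
shift : ℕ → Series → Series
shift zero    f n       = f n
shift (suc a) f zero    = false
shift (suc a) f (suc n) = shift a f n

mul1+ : ℕ → Series → Series
mul1+ k f = f ⊕ shift k f

Σ≤ : ℕ → (ℕ → Series) → Series
Σ≤ zero    t = t 0
Σ≤ (suc k) t = Σ≤ k t ⊕ t (suc k)

shift-at : ∀ a f n → shift a f (a + n) ≡ f n
shift-at zero    f n = refl
shift-at (suc a) f n = shift-at a f n

shift-below : ∀ {a n} f → n < a → shift a f n ≡ false
shift-below {suc a} {zero}  f _         = refl
shift-below {suc a} {suc n} f (s≤s n<a) = shift-below f n<a

shift-cong-≤ : ∀ {f g n} a → (∀ {m} → m ≤ n → f m ≡ g m) → shift a f n ≡ shift a g n
shift-cong-≤         zero    p = p ≤-refl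
shift-cong-≤ {n = zero}  (suc a) p = refl
shift-cong-≤ {n = suc n} (suc a) p = shift-cong-≤ a (λ m≤n → p (m≤n⇒m≤1+n m≤n))

shift-⊕′ : ∀ a f g n → shift a (f ⊕ g) n ≡ shift a f n xor shift a g n
shift-⊕′ zero    f g n       = refl
shift-⊕′ (suc a) f g zero    = refl
shift-⊕′ (suc a) f g (suc n) = shift-⊕′ a f g n

shift-shift′ : ∀ a b f n → shift a (shift b f) n ≡ shift (a + b) f n
shift-shift′ zero    b f n       = refl
shift-shift′ (suc a) b f zero    = refl
shift-shift′ (suc a) b f (suc n) = shift-shift′ a b f n

-- Only coefficients up to q^N matter for `c₁ N`, and modulo q^(N+1) the infinite sums and products
-- of the argument become finite.
module Truncated (N : ℕ) where

  infix 4 _≈_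

  -- Congruence modulo q^(N+1).
  record _≈_ (f g : Series) : Set where
    constructor mk
    field at : ∀ {n} → n ≤ N → f n ≡ g n
  open _≈_ public

  ⊕-commutativeMonoid : CommutativeMonoid 0ℓ 0ℓ
  ⊕-commutativeMonoid = record
    { Carrier = Series ; _≈_ = _≈_ ; _∙_ = _⊕_ ; ε = 𝟘
    ; isCommutativeMonoid = record
      { isMonoid = record
        { isSemigroup = record
          { isMagma = record
            { isEquivalence = record
              { refl  = mk λ _ → refl
              ; sym   = λ p → mk λ n≤N → sym (at p n≤N)
              ; trans = λ p q → mk λ n≤N → trans (at p n≤N) (at q n≤N)
              }
            ; ∙-cong = λ p q → mk λ n≤N → cong₂ _xor_ (at p n≤N) (at q n≤N)
            }
          ; assoc = λ f g h → mk λ {n} _ → xor-assoc (f n) (g n) (h n)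
          }
        ; identity = (λ f → mk λ _ → refl) , (λ f → mk λ {n} _ → xor-identityʳ (f n))
        }
      ; comm = λ f g → mk λ {n} _ → xor-comm (f n) (g n)
      }
    }

  open CommutativeMonoid ⊕-commutativeMonoid public
    using (setoid; commutativeSemigroup)
    renaming (refl to ≈-refl; sym to ≈-sym; trans to ≈-trans;
              ∙-cong to ⊕-cong; ∙-congˡ to ⊕-congˡ; ∙-congʳ to ⊕-congʳ;
              assoc to ⊕-assoc; comm to ⊕-comm; identityʳ to ⊕-identityʳ)
  open CommutativeSemigroupProperties commutativeSemigroup public using (interchange)
  open SetoidReasoning setoid

  ⊕-same : ∀ f → f ⊕ f ≈ 𝟘
  ⊕-same f = mk λ {n} _ → xor-same (f n)

  ⊕-cancelʳ : ∀ f g → (f ⊕ g) ⊕ g ≈ f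
  ⊕-cancelʳ f g = begin
    (f ⊕ g) ⊕ g ≈⟨ ⊕-assoc f g g ⟩
    f ⊕ (g ⊕ g) ≈⟨ ⊕-congˡ {f} (⊕-same g) ⟩
    f ⊕ 𝟘       ≈⟨ ⊕-identityʳ f ⟩
    f           ∎

  shift-cong : ∀ {f g} a → f ≈ g → shift a f ≈ shift a g
  shift-cong a p = mk λ n≤N → shift-cong-≤ a (λ m≤n → at p (≤-trans m≤n n≤N))

  shift-exp : ∀ {a b} f → a ≡ b → shift a f ≈ shift b f
  shift-exp f refl = ≈-refl

  shift-⊕ : ∀ a f g → shift a (f ⊕ g) ≈ shift a f ⊕ shift a g
  shift-⊕ a f g = mk λ {n} _ → shift-⊕′ a f g n

  shift-shift : ∀ a b f → shift a (shift b f) ≈ shift (a + b) f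
  shift-shift a b f = mk λ {n} _ → shift-shift′ a b f n

  shift-large : ∀ {a} f → N < a → shift a f ≈ 𝟘
  shift-large f N<a = mk λ n≤N → shift-below f (≤-trans (s≤s n≤N) N<a)

  shift-comm : ∀ a b f → shift a (shift b f) ≈ shift b (shift a f)
  shift-comm a b f = begin
    shift a (shift b f) ≈⟨ shift-shift a b f ⟩
    shift (a + b) f     ≈⟨ shift-exp f (+-comm a b) ⟩
    shift (b + a) f     ≈⟨ shift-shift b a f ⟨
    shift b (shift a f) ∎

  -- Linearity over the polynomials in q. It stands in for a product of series: every operator used
  -- is multiplication by a fixed polynomial, and the argument moves it past sums and powers of q.
  record IsLinear (F : Series → Series) : Set where
    field
      resp  : ∀ {f g} → f ≈ g → F f ≈ F g
      add   : ∀ f g → F (f ⊕ g) ≈ F f ⊕ F g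
      comm-shift : ∀ k f → F (shift k f) ≈ shift k (F f)

    comm-mul1+ : ∀ k f → F (mul1+ k f) ≈ mul1+ k (F f)
    comm-mul1+ k f = ≈-trans (add f (shift k f)) (⊕-congˡ {F f} (comm-shift k f))

    zero-resp : F 𝟘 ≈ 𝟘
    zero-resp = begin
      -- The zero series is its own shift by N + 1, and `F` carries that shift outside, where it
      -- kills everything modulo q^(N+1).
      F 𝟘                 ≈⟨ resp (shift-large 𝟘 ≤-refl) ⟨
      F (shift (suc N) 𝟘) ≈⟨ comm-shift (suc N) 𝟘 ⟩
      shift (suc N) (F 𝟘) ≈⟨ shift-large (F 𝟘) ≤-refl ⟩
      𝟘                   ∎
  open IsLinear public

  shift-linear : ∀ a → IsLinear (shift a)
  shift-linear a = record { resp = shift-cong a ; add = shift-⊕ a ; comm-shift = shift-comm a }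

  mul1+-linear : ∀ a → IsLinear (mul1+ a)
  mul1+-linear a = record
    { resp = λ p → ⊕-cong p (shift-cong a p)
    ; add = λ f g → ≈-trans (⊕-congˡ {f ⊕ g} (shift-⊕ a f g)) (interchange f g (shift a f) (shift a g))
    ; comm-shift = λ k f → ≈-trans (⊕-congˡ {shift k f} (shift-comm a k f)) (≈-sym (shift-⊕ k f (shift a f)))
    }

  ∘-linear : ∀ {F G} → IsLinear F → IsLinear G → IsLinear (F ∘ G)
  ∘-linear {F} {G} F-lin G-lin = record
    { resp = λ p → resp F-lin (resp G-lin p)
    ; add = λ f g → ≈-trans (resp F-lin (add G-lin f g)) (add F-lin (G f) (G g))
    ; comm-shift = λ k f → ≈-trans (resp F-lin (comm-shift G-lin k f)) (comm-shift F-lin k (G f))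
    }

  mul1+-large : ∀ {k} f → N < k → mul1+ k f ≈ f
  mul1+-large f N<k = ≈-trans (⊕-congˡ {f} (shift-large f N<k)) (⊕-identityʳ f)

  -- Multiplication by the finite product of 1 + q^i over a < i ≤ a + m.
  mulProd : ℕ → ℕ → Series → Series
  mulProd zero    a f = f
  mulProd (suc m) a f = mul1+ (suc a) (mulProd m (suc a) f)

  mulProd-linear : ∀ m a → IsLinear (mulProd m a)
  mulProd-linear zero    a = record { resp = λ p → p ; add = λ _ _ → ≈-refl ; comm-shift = λ _ _ → ≈-refl }
  mulProd-linear (suc m) a = ∘-linear (mul1+-linear (suc a)) (mulProd-linear m (suc a))

  -- The additional factor is 1 + q^(a+m+1), whose exponent exceeds N.
  mulProd-extend : ∀ m a f → N ≤ m + a → mulProd (suc m) a f ≈ mulProd m a f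
  mulProd-extend zero    a f N≤a = mul1+-large f (s≤s N≤a)
  mulProd-extend (suc m) a f N≤  =
    resp (mul1+-linear (suc a)) (mulProd-extend m (suc a) f (subst (N ≤_) (sym (+-suc m a)) N≤))

  mulProd-large : ∀ m {a} f → N ≤ a → mulProd m a f ≈ f
  mulProd-large zero    f N≤a = ≈-refl
  mulProd-large (suc m) {a} f N≤a =
    ≈-trans (mul1+-large (mulProd m (suc a) f) (s≤s N≤a)) (mulProd-large m f (m≤n⇒m≤1+n N≤a))

  -- Multiplication by ∏_{i > a} (1 + q^i): the factors beyond a + N do not matter modulo q^(N+1).
  mulTail : ℕ → Series → Series
  mulTail = mulProd N

  mulTail-linear : ∀ a → IsLinear (mulTail a)
  mulTail-linear = mulProd-linear N

  -- The right-hand side is by definition a product of N + 1 factors starting at 1 + q^(a+1); the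
  -- last of them is trivial modulo q^(N+1).
  mulTail-unfold : ∀ a f → mulTail a f ≈ mul1+ (suc a) (mulTail (suc a) f)
  mulTail-unfold a f = ≈-sym (mulProd-extend N a f (m≤m+n N a))

  mulTail-index : ∀ {a b} f → a ≡ b → mulTail a f ≈ mulTail b f
  mulTail-index f refl = ≈-refl

  -- Finite sums of series

  Σ-cong : ∀ k {s t : ℕ → Series} → (∀ v → s v ≈ t v) → Σ≤ k s ≈ Σ≤ k t
  Σ-cong zero    p = p 0
  Σ-cong (suc k) p = ⊕-cong (Σ-cong k p) (p (suc k))

  Σ-⊕ : ∀ k (s t : ℕ → Series) → Σ≤ k (λ v → s v ⊕ t v) ≈ Σ≤ k s ⊕ Σ≤ k t
  Σ-⊕ zero    s t = ≈-refl
  Σ-⊕ (suc k) s t = ≈-trans (⊕-congʳ {s (suc k) ⊕ t (suc k)} (Σ-⊕ k s t))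
                            (interchange (Σ≤ k s) (Σ≤ k t) (s (suc k)) (t (suc k)))

  Σ-shift : ∀ k a (t : ℕ → Series) → Σ≤ k (λ v → shift a (t v)) ≈ shift a (Σ≤ k t)
  Σ-shift zero    a t = ≈-refl
  Σ-shift (suc k) a t = ≈-trans (⊕-congʳ {shift a (t (suc k))} (Σ-shift k a t))
                                (≈-sym (shift-⊕ a (Σ≤ k t) (t (suc k))))

  Σ-first : ∀ k (t : ℕ → Series) → Σ≤ (suc k) t ≈ t 0 ⊕ Σ≤ k (t ∘ suc)
  Σ-first zero    t = ≈-refl
  Σ-first (suc k) t = ≈-trans (⊕-congʳ {t (suc (suc k))} (Σ-first k t))
                              (⊕-assoc (t 0) (Σ≤ k (t ∘ suc)) (t (suc (suc k))))

  Σ-drop : ∀ k (t : ℕ → Series) → t (suc k) ≈ 𝟘 → Σ≤ (suc k) t ≈ Σ≤ k t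
  Σ-drop k t p = ≈-trans (⊕-congˡ {Σ≤ k t} p) (⊕-identityʳ (Σ≤ k t))

  Σ-only-zero : ∀ k (t : ℕ → Series) → (∀ v → t (suc v) ≈ 𝟘) → Σ≤ k t ≈ t 0
  Σ-only-zero zero    t p = ≈-refl
  Σ-only-zero (suc k) t p = ≈-trans (Σ-drop k t (p k)) (Σ-only-zero k t p)

  -- The series U_v enters through its recurrence, in which the denominator has been multiplied out,
  -- so no series has to be inverted.
  module Telescope
    (U : ℕ → Series)
    (U-zero   : U 0 ≈ 𝟙)
    (U-suc    : ∀ v → mul1+ (suc v) (U (suc v)) ≈ shift (2 * suc v) (U v))
    (U-vanish : U (suc N) ≈ 𝟘)
    where

    Yterm Dterm : ℕ → ℕ → Series
    Yterm r v = shift (v * r) (mulTail (v + r) (U v))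
    Dterm r v = shift (v * r) (mulTail (suc (v + r)) (U v))

    -- The recurrence makes U v divisible by q^(v(v+1)), so modulo q^(N+1) the sums may stop at v =
    -- N.
    Y D : ℕ → Series
    Y r = Σ≤ N (Yterm r)
    D r = Σ≤ N (Dterm r)

    -- With X the product over i > v + r + 1 applied to U v, the first summand is q^(vr) (1 +
    -- q^(v+r+1)) X. The second is q^(vr+v+r+1) X, which cancels in characteristic 2.
    Yterm-split : ∀ r v → Yterm r v ⊕ shift (suc r) (Yterm (suc r) v) ≈ Dterm r v
    Yterm-split r v = begin
      Yterm r v ⊕ shift (suc r) (Yterm (suc r) v)
        ≈⟨ ⊕-cong (≈-trans (shift-cong (v * r) (mulTail-unfold (v + r) (U v)))
                           (shift-⊕ (v * r) X (shift (suc (v + r)) X)))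
                  shifted ⟩
      (shift (v * r) X ⊕ shift (v * r) (shift (suc (v + r)) X)) ⊕ shift (v * r) (shift (suc (v + r)) X)
        ≈⟨ ⊕-cancelʳ (shift (v * r) X) (shift (v * r) (shift (suc (v + r)) X)) ⟩
      Dterm r v ∎
      where
      X = mulTail (suc (v + r)) (U v)
      exps : ∀ r v → suc r + v * suc r ≡ v * r + suc (v + r)
      exps = solve-∀
      shifted : shift (suc r) (Yterm (suc r) v) ≈ shift (v * r) (shift (suc (v + r)) X)
      shifted = begin
        shift (suc r) (shift (v * suc r) (mulTail (v + suc r) (U v)))
          ≈⟨ shift-cong (suc r) (shift-cong (v * suc r) (mulTail-index (U v) (+-suc v r))) ⟩
        shift (suc r) (shift (v * suc r) X) ≈⟨ shift-shift (suc r) (v * suc r) X ⟩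
        shift (suc r + v * suc r) X         ≈⟨ shift-exp X (exps r v) ⟩
        shift (v * r + suc (v + r)) X       ≈⟨ shift-shift (v * r) (suc (v + r)) X ⟨
        shift (v * r) (shift (suc (v + r)) X) ∎

    Y-split : ∀ r → Y r ⊕ shift (suc r) (Y (suc r)) ≈ D r
    Y-split r = begin
      Y r ⊕ shift (suc r) (Y (suc r))
        ≈⟨ ⊕-congˡ {Y r} (Σ-shift N (suc r) (Yterm (suc r))) ⟨
      Y r ⊕ Σ≤ N (λ v → shift (suc r) (Yterm (suc r) v))
        ≈⟨ Σ-⊕ N (Yterm r) (λ v → shift (suc r) (Yterm (suc r) v)) ⟨
      Σ≤ N (λ v → Yterm r v ⊕ shift (suc r) (Yterm (suc r) v))
        ≈⟨ Σ-cong N (Yterm-split r) ⟩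
      D r ∎

    -- The factor 1 + q^v cancels the last denominator of U v, so the v-th term of
    -- D r + Y (r + 1) becomes the (v - 1)-st term of q^(r+2) Y (r + 2).
    Eterm : ℕ → ℕ → Series
    Eterm r v = shift (v * r) (mulTail (suc (v + r)) (mul1+ v (U v)))

    Eterm-split : ∀ r v → Dterm r v ⊕ Yterm (suc r) v ≈ Eterm r v
    Eterm-split r v = begin
      shift (v * r) X ⊕ shift (v * suc r) (mulTail (v + suc r) (U v))
        ≈⟨ ⊕-congˡ {shift (v * r) X} (begin
             shift (v * suc r) (mulTail (v + suc r) (U v))
               ≈⟨ shift-cong (v * suc r) (mulTail-index (U v) (+-suc v r)) ⟩
             shift (v * suc r) X       ≈⟨ shift-exp X (exps r v) ⟩
             shift (v * r + v) X       ≈⟨ shift-shift (v * r) v X ⟨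
             shift (v * r) (shift v X) ∎) ⟩
      shift (v * r) X ⊕ shift (v * r) (shift v X) ≈⟨ shift-⊕ (v * r) X (shift v X) ⟨
      shift (v * r) (mul1+ v X)
        ≈⟨ shift-cong (v * r) (comm-mul1+ (mulTail-linear (suc (v + r))) v (U v)) ⟨
      Eterm r v ∎
      where
      X = mulTail (suc (v + r)) (U v)
      exps : ∀ r v → v * suc r ≡ v * r + v
      exps = solve-∀

    -- At v = 0 the factor 1 + q^v is 1 + 1 = 0.
    Eterm-zero : ∀ r → Eterm r 0 ≈ 𝟘
    Eterm-zero r = ≈-trans (resp (mulTail-linear (suc r)) (⊕-same (U 0)))
                           (zero-resp (mulTail-linear (suc r)))

    -- The recurrence trades 1 + q^(v+1) for q^(2(v+1)), and the total exponent (v+1)r + 2(v+1)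
    -- regroups as (r+2) + v(r+2).
    Eterm-suc : ∀ r v → Eterm r (suc v) ≈ shift (suc (suc r)) (Yterm (suc (suc r)) v)
    Eterm-suc r v = begin
      shift (suc v * r) (mulTail (suc (suc v + r)) (mul1+ (suc v) (U (suc v))))
        ≈⟨ shift-cong (suc v * r) (≈-trans (resp lin (U-suc v)) (comm-shift lin (2 * suc v) (U v))) ⟩
      shift (suc v * r) (shift (2 * suc v) (mulTail (suc (suc v + r)) (U v)))
        ≈⟨ shift-cong (suc v * r) (shift-cong (2 * suc v) (mulTail-index (U v) (indices r v))) ⟩
      shift (suc v * r) (shift (2 * suc v) X)   ≈⟨ shift-shift (suc v * r) (2 * suc v) X ⟩
      shift (suc v * r + 2 * suc v) X           ≈⟨ shift-exp X (exps r v) ⟩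
      shift (suc (suc r) + v * suc (suc r)) X   ≈⟨ shift-shift (suc (suc r)) (v * suc (suc r)) X ⟨
      shift (suc (suc r)) (shift (v * suc (suc r)) X) ∎
      where
      X = mulTail (v + suc (suc r)) (U v)
      lin = mulTail-linear (suc (suc v + r))
      indices : ∀ r v → suc (suc v + r) ≡ v + suc (suc r)
      indices = solve-∀
      exps : ∀ r v → suc v * r + 2 * suc v ≡ suc (suc r) + v * suc (suc r)
      exps = solve-∀

    Eterm-vanish : ∀ r → Eterm r (suc N) ≈ 𝟘
    Eterm-vanish r = ≈-trans
      (resp lin (≈-trans (resp (mul1+-linear (suc N)) U-vanish) (zero-resp (mul1+-linear (suc N)))))
      (zero-resp lin)
      where lin = ∘-linear (shift-linear (suc N * r)) (mulTail-linear (suc (suc N + r)))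

    DY-split : ∀ r → D r ⊕ Y (suc r) ≈ shift (suc (suc r)) (Y (suc (suc r)))
    DY-split r = begin
      D r ⊕ Y (suc r)                              ≈⟨ Σ-⊕ N (Dterm r) (Yterm (suc r)) ⟨
      Σ≤ N (λ v → Dterm r v ⊕ Yterm (suc r) v)     ≈⟨ Σ-cong N (Eterm-split r) ⟩
      -- Padding with the vanishing term v = N + 1 lets the sum run over 0, ..., N again once the
      -- term v = 0 is removed and the index lowered.
      Σ≤ N (Eterm r)                               ≈⟨ Σ-drop N (Eterm r) (Eterm-vanish r) ⟨
      Σ≤ (suc N) (Eterm r)                         ≈⟨ Σ-first N (Eterm r) ⟩
      Eterm r 0 ⊕ Σ≤ N (Eterm r ∘ suc)             ≈⟨ ⊕-cong (Eterm-zero r) (Σ-cong N (Eterm-suc r)) ⟩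
      Σ≤ N (λ v → shift (suc (suc r)) (Yterm (suc (suc r)) v))
        ≈⟨ Σ-shift N (suc (suc r)) (Yterm (suc (suc r))) ⟩
      shift (suc (suc r)) (Y (suc (suc r)))        ∎

    -- Both sides equal Y (r+1) + q^(r+2) Y (r+2): the left by `DY-split`, the right by `Y-split` at
    -- r + 1.
    D-suc : ∀ r → D r ≈ D (suc r)
    D-suc r = begin
      D r                                             ≈⟨ ⊕-cancelʳ (D r) (Y (suc r)) ⟨
      (D r ⊕ Y (suc r)) ⊕ Y (suc r)                   ≈⟨ ⊕-congʳ {Y (suc r)} (DY-split r) ⟩
      shift (suc (suc r)) (Y (suc (suc r))) ⊕ Y (suc r)
        ≈⟨ ⊕-comm (shift (suc (suc r)) (Y (suc (suc r)))) (Y (suc r)) ⟩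
      Y (suc r) ⊕ shift (suc (suc r)) (Y (suc (suc r))) ≈⟨ Y-split (suc r) ⟩
      D (suc r)                                       ∎

    -- The terms with v ≥ 1 carry q^(vr) with vr > N, and in the term v = 0 all factors 1 + q^i have
    -- i > N.
    D-large : ∀ {r} → N < r → D r ≈ 𝟙
    D-large {r} N<r = begin
      D r                 ≈⟨ Σ-only-zero N (Dterm r) (λ v →
                              shift-large (mulTail (suc (suc v + r)) (U (suc v)))
                                          (≤-trans N<r (m≤m+n r (v * r)))) ⟩
      mulTail (suc r) (U 0) ≈⟨ mulProd-large N (U 0) (≤-trans (m≤n⇒m≤1+n ≤-refl) (m≤n⇒m≤1+n N<r)) ⟩
      U 0                 ≈⟨ U-zero ⟩
      𝟙                   ∎

    D≈𝟙 : ∀ r → D r ≈ 𝟙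
    D≈𝟙 r = go (suc N) (m≤m+n (suc N) r)
      where
      go : ∀ m {s} → N < m + s → D s ≈ 𝟙
      go zero        N<s = D-large N<s
      go (suc m) {s} N<  = ≈-trans (D-suc s) (go m (subst (N <_) (sym (+-suc m s)) N<))

    Y-unfold : ∀ r → Y r ≈ 𝟙 ⊕ shift (suc r) (Y (suc r))
    Y-unfold r = begin
      Y r                                                   ≈⟨ ⊕-cancelʳ (Y r) S ⟨
      (Y r ⊕ S) ⊕ S ≈⟨ ⊕-congʳ {S} (≈-trans (Y-split r) (D≈𝟙 r)) ⟩
      𝟙 ⊕ S                       ∎
      where S = shift (suc r) (Y (suc r))

-- Partitions whose repeated parts form an initial segment

concatMap-unique : {f : A → List B} {xs : List A} → Unique xs → (∀ x → Unique (f x)) →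
                   (∀ {x y z} → z ∈ f x → z ∈ f y → x ≡ y) → Unique (concatMap f xs)
concatMap-unique xs! f! inj = Unique.concat⁺ (All.map⁺ (All.universal f! _))
  (AllPairs.map⁺ (AllPairs.map (λ x≢y {_} (z∈x , z∈y) → x≢y (inj z∈x z∈y)) xs!))

-- Duplicate-free lists with the same members are permutations of each other. This later replaces
-- the filtered `candidates` by an explicit enumeration.
unique-length : {xs ys : List A} → Unique xs → Unique ys →
                (∀ {z} → z ∈ xs → z ∈ ys) → (∀ {z} → z ∈ ys → z ∈ xs) → length xs ≡ length ys
unique-length xs! ys! ⊆ ⊇ =
  ↭-length (∼bag⇒↭ (unique∧set⇒bag xs! ys! (mk⇔ ⊆ ⊇)))

∈-listsOf⁻ : ∀ k {n l} → l ∈ listsOf k n → length l ≡ k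
∈-listsOf⁻ zero (here refl) = refl
∈-listsOf⁻ (suc k) {n} l∈ with find (∈-concatMap⁻ (λ a → map (a ∷_) (listsOf k n)) {xs = applyUpTo suc n} l∈)
... | a , _ , l∈a∷ with ∈-map⁻ (a ∷_) l∈a∷
...   | _ , l′∈ , refl = cong suc (∈-listsOf⁻ k l′∈)

∈-listsOf⁺ : ∀ {n l} → All (λ a → 1 ≤ a × a ≤ n) l → l ∈ listsOf (length l) n
∈-listsOf⁺ [] = here refl
∈-listsOf⁺ {n} {suc a ∷ l} ((s≤s _ , a<n) ∷ l≤n) =
  ∈-concatMap⁺ _ (lose (∈-applyUpTo⁺ suc a<n) (∈-map⁺ (suc a ∷_) (∈-listsOf⁺ l≤n)))

suc-range-unique : ∀ n → Unique (applyUpTo suc n)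
suc-range-unique n = Unique.applyUpTo⁺₁ suc n (λ i<j _ → <⇒≢ (s≤s i<j))

listsOf-unique : ∀ k n → Unique (listsOf k n)
listsOf-unique zero    n = [] ∷ []
listsOf-unique (suc k) n = concatMap-unique (suc-range-unique n)
  (λ a → Unique.map⁺ ∷-injectiveʳ (listsOf-unique k n)) same-head
  where
  same-head : ∀ {x y z} → z ∈ map (x ∷_) (listsOf k n) → z ∈ map (y ∷_) (listsOf k n) → x ≡ y
  same-head {x} {y} z∈x z∈y with ∈-map⁻ (x ∷_) z∈x | ∈-map⁻ (y ∷_) z∈y
  ... | _ , _ , refl | _ , _ , eq = ∷-injectiveˡ eq

candidates-unique : ∀ n → Unique (candidates n)
candidates-unique n = concatMap-unique (Unique.applyUpTo⁺₁ id (suc n) (λ i<j _ → <⇒≢ i<j))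
  (λ k → listsOf-unique k n)
  (λ {x} {y} z∈x z∈y → trans (sym (∈-listsOf⁻ x z∈x)) (∈-listsOf⁻ y z∈y))

-- Partitions with parts at most b; the bound is an index so that induction on the largest allowed
-- part is possible.
data Desc : ℕ → List ℕ → Set where
  []   : Desc b []
  cons : ∀ {a} → 1 ≤ a → a ≤ b → Desc a l → Desc b (a ∷ l)

Desc-weaken : ∀ {c} → b ≤ c → Desc b l → Desc c l
Desc-weaken b≤c []               = []
Desc-weaken b≤c (cons 1≤a a≤b d) = cons 1≤a (≤-trans a≤b b≤c) d

Desc-all : Desc b l → All (λ a → 1 ≤ a × a ≤ b) l
Desc-all []               = []
Desc-all (cons 1≤a a≤b d) =
  (1≤a , a≤b) ∷ All.map (λ (1≤c , c≤a) → 1≤c , ≤-trans c≤a a≤b) (Desc-all d)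

Desc-length : Desc b l → length l ≤ sum l
Desc-length []             = z≤n
Desc-length (cons 1≤a _ d) = +-mono-≤ 1≤a (Desc-length d)

Desc-split : Desc (suc b) l → Desc b l ⊎ (∃[ l′ ] l ≡ suc b ∷ l′ × Desc (suc b) l′)
Desc-split [] = inj₁ []
Desc-split {b} (cons {a = a} 1≤a a≤ d) with a ≟ suc b
... | yes refl = inj₂ (_ , refl , d)
... | no  a≢   = inj₁ (cons 1≤a (≤-pred (≤∧≢⇒< a≤ a≢)) d)

Desc-isPartitionOf : Desc b l → sum l ≡ n → T (isPartitionOf n l)
Desc-isPartitionOf {b} {l} {n} d refl =
  from T-∧ (pos d , from (T-∧ {nonIncreasing l}) (desc d , ≡⇒≡ᵇ (sum l) (sum l) refl))
  where
  pos : ∀ {b l} → Desc b l → T (positive l)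
  pos d = All.all⁻ (1 ≤ᵇ_) (All.map (λ (1≤a , _) → ≤⇒≤ᵇ 1≤a) (Desc-all d))
  desc : ∀ {b l} → Desc b l → T (nonIncreasing l)
  desc []                              = _
  desc (cons _ _ [])                   = _
  desc (cons _ _ d@(cons _ c≤a _)) = from T-∧ (≤⇒≤ᵇ c≤a , desc d)

isPartitionOf-Desc : ∀ l → T (isPartitionOf n l) → Desc n l × sum l ≡ n
isPartitionOf-Desc {n} l p with to (T-∧ {positive l}) p
... | pos , q with to (T-∧ {nonIncreasing l}) q
...   | desc , s = subst (λ m → Desc m l) sum≡n (whole l (All.all⁺ (1 ≤ᵇ_) l pos) desc) , sum≡n
  where
  sum≡n = ≡ᵇ⇒≡ (sum l) n s
  go : ∀ {b} a l → a ≤ b → All (T ∘ (1 ≤ᵇ_)) (a ∷ l) → T (nonIncreasing (a ∷ l)) → Desc b (a ∷ l)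
  go a []      a≤b (1≤a ∷ _)   _ = cons (≤ᵇ⇒≤ 1 a 1≤a) a≤b []
  go a (c ∷ l) a≤b (1≤a ∷ pos) q with to (T-∧ {c ≤ᵇ a}) q
  ... | c≤a , q′ = cons (≤ᵇ⇒≤ 1 a 1≤a) a≤b (go c l (≤ᵇ⇒≤ c a c≤a) pos q′)
  whole : ∀ l → All (T ∘ (1 ≤ᵇ_)) l → T (nonIncreasing l) → Desc (sum l) l
  whole []      _   _    = []
  whole (a ∷ l) pos desc = go a l (m≤m+n a (sum l)) pos desc

Desc-candidate : Desc n l → sum l ≡ n → l ∈ candidates n
Desc-candidate {n} {l} d refl =
  ∈-concatMap⁺ (λ k → listsOf k (sum l)) (lose (∈-applyUpTo⁺ id (s≤s (Desc-length d))) (∈-listsOf⁺ (Desc-all d)))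

-- Multiplicities and repeated parts

mult-same : ∀ k l → mult k (k ∷ l) ≡ suc (mult k l)
mult-same k l with k ≡ᵇ k | ≡⇒≡ᵇ k k refl
... | true | _ = refl

mult-≢ : ∀ {a} l → a ≢ k → mult k (a ∷ l) ≡ mult k l
mult-≢ {k} {a} l a≢k with a ≡ᵇ k | ≡ᵇ⇒≡ a k
... | false | _  = refl
... | true  | eq = contradiction (eq _) a≢k

mult-mono : ∀ k a l → mult k l ≤ mult k (a ∷ l)
mult-mono k a l with a ≡ᵇ k
... | false = ≤-refl
... | true  = n≤1+n _

mult-∈ : 1 ≤ mult k l → k ∈ l
mult-∈ {k} {a ∷ l} p with a ≟ k
... | yes refl = here refl
... | no  a≢k  = there (mult-∈ (subst (1 ≤_) (mult-≢ l a≢k) p))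

Repeated : ℕ → List ℕ → Set
Repeated k l = 2 ≤ mult k l

RepeatedUpTo : ℕ → List ℕ → Set
RepeatedUpTo b l = ∀ {i} → 1 ≤ i → i ≤ b → Repeated i l

-- Downward closure among the positive integers: in a partition, the repeated parts are exactly 1,
-- ..., v for some v ≥ 0.
InitialRepeats : List ℕ → Set
InitialRepeats l = ∀ {i k} → 1 ≤ i → i < k → Repeated k l → Repeated i l

repeated-∷ : ∀ {k l} a → Repeated k l → Repeated k (a ∷ l)
repeated-∷ {k} {l} a p = ≤-trans p (mult-mono k a l)

repeated-∷⁻ : ∀ {k a l} → a ≢ k → Repeated k (a ∷ l) → Repeated k l
repeated-∷⁻ {l = l} a≢k = subst (2 ≤_) (mult-≢ l a≢k)

repeated-bounds : Desc b l → Repeated k l → 1 ≤ k × k ≤ b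
repeated-bounds d p = All.lookup (Desc-all d) (mult-∈ (≤-trans (s≤s z≤n) p))

repeated-twice : ∀ k l → Repeated k (k ∷ k ∷ l)
repeated-twice k l = subst (2 ≤_)
  (sym (trans (mult-same k (k ∷ l)) (cong suc (mult-same k l)))) (s≤s (s≤s z≤n))

mult≤1 : ∀ k l → ¬ Repeated k l → T (mult k l ≤ᵇ 1)
mult≤1 k l ¬p = ≤⇒≤ᵇ {mult k l} {1} (≤-pred (≰⇒> ¬p))

mult≤1⁻ : ∀ k l → T (mult k l ≤ᵇ 1) → ¬ Repeated k l
mult≤1⁻ k l p q = <-irrefl refl (≤-trans q (≤ᵇ⇒≤ (mult k l) 1 p))

-- In case (a) nothing is repeated. In case (b) a repeated k has k ≤ 2j, so i < k gives i ≤ 2j - 1,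
-- and all positive integers up to 2j - 1 are repeated.
c₁cond⇒initial : ∀ l → T (c₁cond l) → InitialRepeats l
c₁cond⇒initial l c {i} {k} 1≤i i<k kk with to (T-∨ {allDistinct l}) c
... | inj₁ dist = contradiction kk
  (mult≤1⁻ k l (All.lookup (All.all⁺ (λ a → mult a l ≤ᵇ 1) l dist) (mult-∈ (≤-trans (s≤s z≤n) kk))))
... | inj₂ ex with find (Any.any⁻ (λ j → condB j l) (applyUpTo suc (sum l)) ex)
...   | j , _ , cB with to (T-∧ {2 ≤ᵇ mult (2 * j ∸ 1) l}) cB
...     | top , cB′ with to (T-∧ {all (λ i → 2 ≤ᵇ mult i l) (applyUpTo suc (2 * j ∸ 2))}) cB′
...       | below , above = result
  where
  k≤2j : k ≤ 2 * j
  k≤2j with to (T-∨ {k ≤ᵇ 2 * j}) (All.lookup (All.all⁺ _ l above) (mult-∈ (≤-trans (s≤s z≤n) kk)))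
  ... | inj₁ k≤ = ≤ᵇ⇒≤ k (2 * j) k≤
  ... | inj₂ m1 = contradiction kk (mult≤1⁻ k l m1)
  in-range : ∀ {i m} → 1 ≤ i → i ≤ m → i ∈ applyUpTo suc m
  in-range (s≤s _) i≤m = ∈-applyUpTo⁺ suc i≤m
  result : Repeated i l
  result with i ≟ 2 * j ∸ 1
  ... | yes refl = ≤ᵇ⇒≤ 2 (mult (2 * j ∸ 1) l) top
  ... | no  i≢   = ≤ᵇ⇒≤ 2 (mult i l)
    (All.lookup (All.all⁺ (λ i → 2 ≤ᵇ mult i l) _ below) (in-range 1≤i (lt i≢ (≤-trans i<k k≤2j))))
    where
    lt : ∀ {i m} → i ≢ m ∸ 1 → i < m → i ≤ m ∸ 2
    lt {i} {suc zero}    i≢ (s≤s z≤n) = z≤n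
    lt {i} {suc (suc m)} i≢ (s≤s i≤)  = ≤-pred (≤∧≢⇒< i≤ i≢)

largest-repeated : ∀ l m → (∀ {k} → Repeated k l → 1 ≤ k × k ≤ m) →
  (∀ {k} → ¬ Repeated k l) ⊎ (∃[ v ] Repeated v l × (∀ {k} → Repeated k l → k ≤ v))
largest-repeated l zero    bd = inj₁ (λ p → <⇒≱ (proj₁ (bd p)) (proj₂ (bd p)))
largest-repeated l (suc m) bd with 2 ≤? mult (suc m) l
... | yes p = inj₂ (suc m , p , λ q → proj₂ (bd q))
... | no ¬p = largest-repeated l m (λ {k} q →
  proj₁ (bd q) , ≤-pred (≤∧≢⇒< (proj₂ (bd q)) (λ k≡ → ¬p (subst (λ k → Repeated k l) k≡ q))))

-- The witness is v/2 rounded up. Both parities occur because condition (b) leaves open whether 2j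
-- is repeated.
half-up : ∀ v → 1 ≤ v → ∃[ j ] 1 ≤ j × j ≤ v × (v ≡ 2 * j ∸ 1 ⊎ v ≡ 2 * j)
half-up (suc zero)          _ = 1 , s≤s z≤n , ≤-refl , inj₁ refl
half-up (suc (suc zero))    _ = 1 , s≤s z≤n , s≤s z≤n , inj₂ refl
half-up (suc (suc v@(suc _))) _ with half-up v (s≤s z≤n)
... | suc j , _ , j≤v , eq = suc (suc j) , s≤s z≤n , s≤s (m≤n⇒m≤1+n j≤v) , step eq
  where
  2+ : ∀ j → 2 * suc (suc j) ≡ suc (suc (2 * suc j))
  2+ = solve-∀
  step : v ≡ 2 * suc j ∸ 1 ⊎ v ≡ 2 * suc j →
         suc (suc v) ≡ 2 * suc (suc j) ∸ 1 ⊎ suc (suc v) ≡ 2 * suc (suc j)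
  step (inj₁ eq) = inj₁ (trans (cong (suc ∘ suc) eq) (sym (cong (_∸ 1) (2+ j))))
  step (inj₂ eq) = inj₂ (trans (cong (suc ∘ suc) eq) (sym (2+ j)))

∈⇒≤sum : ∀ {a} → a ∈ l → a ≤ sum l
∈⇒≤sum {a ∷ l} (here refl) = m≤m+n a (sum l)
∈⇒≤sum {c ∷ l} (there a∈l) = ≤-trans (∈⇒≤sum a∈l) (m≤n+m (sum l) c)

-- If some part is repeated, let v be the largest such part and take j with 2j - 1 ≤ v ≤ 2j.
-- Everything up to v is repeated, and everything above 2j is above v, hence distinct.
initial⇒c₁cond : Desc b l → InitialRepeats l → T (c₁cond l)
initial⇒c₁cond {b} {l} d init with largest-repeated l b (repeated-bounds d)
... | inj₁ none = from T-∨ (inj₁ (All.all⁻ _ (All.universal (λ a → mult≤1 a l none) l)))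
... | inj₂ (v , vv , max) with half-up v (proj₁ (repeated-bounds d vv))
...   | suc j , _ , j≤v , v≡ = from (T-∨ {allDistinct l}) (inj₂ (Any.any⁺ (λ j → condB j l) (lose
    -- The witness lies in the range searched by `existsB`: it is at most v, and v is a part.
    (∈-applyUpTo⁺ suc (≤-trans j≤v (∈⇒≤sum (mult-∈ {l = l} (≤-trans (s≤s z≤n) vv)))))
    (from T-∧ (≤⇒≤ᵇ (down (≤-trans (s≤s z≤n) (m≤n+m (1 * suc j) j)) 2j∸1≤v) , from T-∧
      (All.all⁻ _ (All.tabulate below) , All.all⁻ _ (All.universal above l)))))))
  where
  2j∸1≤v : 2 * suc j ∸ 1 ≤ v
  2j∸1≤v = [ (λ v≡ → ≤-reflexive (sym v≡))
           , (λ v≡ → ≤-trans (m∸n≤m (2 * suc j) 1) (≤-reflexive (sym v≡))) ]′ v≡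
  v≤2j : v ≤ 2 * suc j
  v≤2j = [ (λ v≡ → ≤-trans (≤-reflexive v≡) (m∸n≤m (2 * suc j) 1)) , ≤-reflexive ]′ v≡
  down : ∀ {i} → 1 ≤ i → i ≤ v → Repeated i l
  down {i} 1≤i i≤v with i ≟ v
  ... | yes refl = vv
  ... | no  i≢v  = init 1≤i (≤∧≢⇒< i≤v i≢v) vv
  below : ∀ {i} → i ∈ applyUpTo suc (2 * suc j ∸ 2) → T (2 ≤ᵇ mult i l)
  below i∈ with ∈-applyUpTo⁻ suc i∈
  ... | i′ , i′< , refl = ≤⇒≤ᵇ (down (s≤s z≤n)
    (≤-trans i′< (≤-trans (∸-monoʳ-≤ (2 * suc j) (s≤s (z≤n {1}))) 2j∸1≤v)))
  above : ∀ a → T ((a ≤ᵇ 2 * suc j) ∨ (mult a l ≤ᵇ 1))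
  above a with 2 ≤? mult a l
  ... | yes p = from T-∨ (inj₁ (≤⇒≤ᵇ (≤-trans (max p) v≤2j)))
  ... | no ¬p = from (T-∨ {a ≤ᵇ 2 * suc j}) (inj₂ (mult≤1 a l ¬p))

-- Enumeration and generating functions

-- Between 0 and m copies of b are put in front of each list: the geometric series for 1/(1 - q^b),
-- cut off after q^(mb).
block : ℕ → ℕ → List (List ℕ) → List (List ℕ)
block zero    b xs = xs
block (suc m) b xs = xs ++ map (b ∷_) (block m b xs)

-- The generating function by sum with coefficients reduced mod 2, so that the parity of a count is
-- a coefficient.
gf : List (List ℕ) → Series
gf []       n = false
gf (l ∷ ls) n = (sum l ≡ᵇ n) xor gf ls n

gf-++ : ∀ xs ys n → gf (xs ++ ys) n ≡ (gf xs ⊕ gf ys) n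
gf-++ []       ys n = refl
gf-++ (l ∷ xs) ys n =
  trans (cong ((sum l ≡ᵇ n) xor_) (gf-++ xs ys n)) (sym (xor-assoc (sum l ≡ᵇ n) (gf xs n) (gf ys n)))

shift-≡ᵇ : ∀ a s n → (a + s ≡ᵇ n) ≡ shift a (s ≡ᵇ_) n
shift-≡ᵇ zero    s n       = refl
shift-≡ᵇ (suc a) s zero    = refl
shift-≡ᵇ (suc a) s (suc n) = shift-≡ᵇ a s n

shift-𝟘 : ∀ a n → shift a 𝟘 n ≡ false
shift-𝟘 zero    n       = refl
shift-𝟘 (suc a) zero    = refl
shift-𝟘 (suc a) (suc n) = shift-𝟘 a n

gf-map-∷ : ∀ a xs n → gf (map (a ∷_) xs) n ≡ shift a (gf xs) n
gf-map-∷ a []       n = sym (shift-𝟘 a n)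
gf-map-∷ a (l ∷ xs) n = trans (cong₂ _xor_ (shift-≡ᵇ a (sum l) n) (gf-map-∷ a xs n))
                              (sym (shift-⊕′ a (sum l ≡ᵇ_) (gf xs) n))

-- Parity of counts

odd : ℕ → Bool
odd zero    = false
odd (suc n) = not (odd n)

odd-%2 : ∀ n → n % 2 ≡ 1 ⇔ odd n ≡ true
odd-%2 zero          = mk⇔ (λ ()) (λ ())
odd-%2 (suc zero)    = mk⇔ (λ _ → refl) (λ _ → refl)
odd-%2 (suc (suc n)) = subst (λ b → n % 2 ≡ 1 ⇔ b ≡ true) (sym (not-involutive (odd n))) (odd-%2 n)

odd-length-gf : ∀ xs n → odd (length (filterᵇ (λ l → sum l ≡ᵇ n) xs)) ≡ gf xs n
odd-length-gf []       n = refl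
odd-length-gf (l ∷ xs) n with sum l ≡ᵇ n
... | false = odd-length-gf xs n
... | true  = cong not (odd-length-gf xs n)

map-∷-disjoint : ∀ {ys} → (∀ {l} → l ∈ xs → Desc b l) →
                 ∀ {l} → ¬ (l ∈ xs × l ∈ map (suc b ∷_) ys)
map-∷-disjoint {b = b} bd (l∈xs , l∈) with ∈-map⁻ (suc b ∷_) l∈
... | _ , _ , refl with bd l∈xs
...   | cons _ sb≤b _ = 1+n≰n sb≤b

block-unique : ∀ m → (∀ {l} → l ∈ xs → Desc b l) → Unique xs → Unique (block m (suc b) xs)
block-unique zero    bd xs! = xs!
block-unique (suc m) bd xs! =
  Unique.++⁺ xs! (Unique.map⁺ ∷-injectiveʳ (block-unique m bd xs!)) (map-∷-disjoint bd)

block-sound : ∀ m → (∀ {l} → l ∈ xs → Desc b l × RepeatedUpTo b l) →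
              l ∈ block m (suc b) xs → Desc (suc b) l × RepeatedUpTo b l
block-sound zero sound l∈ with sound l∈
... | d , r = Desc-weaken (n≤1+n _) d , r
block-sound {xs = xs} {b = b} (suc m) sound l∈ with ∈-++⁻ xs l∈
... | inj₁ l∈xs with sound l∈xs
...   | d , r = Desc-weaken (n≤1+n _) d , r
block-sound {xs = xs} {b = b} (suc m) sound l∈ | inj₂ l∈′ with ∈-map⁻ (suc b ∷_) l∈′
... | l′ , l′∈ , refl with block-sound {xs = xs} m sound l′∈
...   | d , r = cons (s≤s z≤n) ≤-refl d , λ {i} 1≤i i≤b → repeated-∷ {i} {l′} (suc b) (r 1≤i i≤b)

-- The length bounds the number of copies of b + 1. The bound n, below which `xs` is complete, stays
-- fixed while m decreases in the induction.
block-complete : ∀ m → (∀ {l} → Desc b l → RepeatedUpTo b l → length l ≤ n → l ∈ xs) →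
                 Desc (suc b) l → RepeatedUpTo b l → length l ≤ m → m ≤ n → l ∈ block m (suc b) xs
block-complete {l = []}     zero    complete d r len m≤n = complete [] r z≤n
block-complete {b} {l = l} (suc m) complete d r len m≤n with Desc-split d
... | inj₁ d′ = ∈-++⁺ˡ (complete d′ r (≤-trans len m≤n))
... | inj₂ (l′ , refl , d′) = ∈-++⁺ʳ _ (∈-map⁺ (suc b ∷_)
  (block-complete m complete d′
    (λ {i} 1≤i i≤b → repeated-∷⁻ {i} {suc b} {l′} (λ { refl → 1+n≰n i≤b }) (r 1≤i i≤b))
    (≤-pred len) (≤-trans (n≤1+n m) m≤n)))

-- The lists gained begin with m + 1 copies of b + 1, so their sum is at least m + 1 > n.
gf-block-stable : ∀ b xs m {n} → n ≤ m → gf (block (suc m) (suc b) xs) n ≡ gf (block m (suc b) xs) n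
gf-block-stable b xs zero {zero} _ =
  trans (gf-++ xs (map (suc b ∷_) xs) 0)
        (trans (cong (gf xs 0 xor_) (gf-map-∷ (suc b) xs 0)) (xor-identityʳ (gf xs 0)))
gf-block-stable b xs (suc m) {n} n≤m =
  trans (expand (suc m)) (trans (cong (gf xs n xor_) (stable n≤m)) (sym (expand m)))
  where
  expand : ∀ m → gf (block (suc m) (suc b) xs) n ≡ gf xs n xor shift (suc b) (gf (block m (suc b) xs)) n
  expand m = trans (gf-++ xs _ n) (cong (gf xs n xor_) (gf-map-∷ (suc b) (block m (suc b) xs) n))
  stable : ∀ {n} → n ≤ suc m → shift (suc b) (gf (block (suc m) (suc b) xs)) n
                              ≡ shift (suc b) (gf (block m (suc b) xs)) n
  stable {zero}  _         = refl
  -- The first unit of the shift by b + 1 lowers the exponent by one, which pays for passing from m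
  -- + 1 to m.
  stable {suc n} (s≤s n≤m) = shift-cong-≤ b (λ k≤n → gf-block-stable b xs m (≤-trans k≤n n≤m))

-- (r+1) + (r+2) + ... + (r+d), the exponent accumulated by unfolding `Y r` d times.
gap : ℕ → ℕ → ℕ
gap zero    r = 0
gap (suc d) r = suc r + gap d (suc r)

tri : ℕ → ℕ
tri zero    = 0
tri (suc j) = suc j + tri j

gap-tri : ∀ d r → gap d r + tri r ≡ tri (d + r)
gap-tri zero    r = refl
gap-tri (suc d) r = trans (swap r (gap d (suc r)) (tri r))
  (trans (gap-tri d (suc r)) (cong tri (+-suc d r)))
  where
  swap : ∀ r g t → suc r + g + t ≡ g + (suc r + t)
  swap = solve-∀

gap-zero : ∀ d → gap d 0 ≡ d * suc d / 2
gap-zero d = trans (sym (+-identityʳ (gap d 0))) (trans (gap-tri d 0)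
  (trans (cong tri (+-identityʳ d)) (sym (trans (cong (_/ 2) (double d)) (m*n/n≡m (tri d) 2)))))
  where
  double : ∀ d → d * suc d ≡ tri d * 2
  double zero    = refl
  double (suc d) = trans (expand d) (trans (cong (2 * suc d +_) (double d)) (collect d (tri d)))
    where
    expand : ∀ d → suc d * suc (suc d) ≡ 2 * suc d + d * suc d
    expand = solve-∀
    collect : ∀ d t → 2 * suc d + t * 2 ≡ (suc d + t) * 2
    collect = solve-∀

-- Enumeration by largest part, and its generating function

module Enumeration (N : ℕ) where
  open Truncated N

  -- N bounds the multiplicity of each part here (up to the two extra copies of the part in `full`),
  -- which loses nothing for partitions of size at most N.
  full : ℕ → List (List ℕ)
  full zero    = [] ∷ []
  full (suc b) = map (suc b ∷_) (map (suc b ∷_) (block N (suc b) (full b)))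

  -- The part b + 1 is absent, occurs once, or is repeated; in the last case every smaller positive
  -- integer must be repeated too.
  initial : ℕ → List (List ℕ)
  initial zero    = [] ∷ []
  initial (suc b) = initial b ++ (map (suc b ∷_) (initial b) ++ full (suc b))

  full-sound : ∀ b → l ∈ full b → Desc b l × RepeatedUpTo b l
  full-sound zero (here refl) = [] , λ 1≤i i≤0 → contradiction (≤-trans 1≤i i≤0) 1+n≰n
  full-sound (suc b) l∈ with ∈-map⁻ (suc b ∷_) l∈
  ... | _ , l∈′ , refl with ∈-map⁻ (suc b ∷_) l∈′
  ...   | l , l∈″ , refl with block-sound {full b} N (full-sound b) l∈″
  ...     | d , r = cons (s≤s z≤n) ≤-refl (cons (s≤s z≤n) ≤-refl d) , rep
    where
    rep : RepeatedUpTo (suc b) (suc b ∷ suc b ∷ l)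
    rep {i} 1≤i i≤ with i ≟ suc b
    ... | yes refl = repeated-twice i l
    ... | no  i≢   = repeated-∷ {i} {suc b ∷ l} (suc b)
                       (repeated-∷ {i} {l} (suc b) (r 1≤i (≤-pred (≤∧≢⇒< i≤ i≢))))

  full-complete : ∀ b → Desc b l → RepeatedUpTo b l → length l ≤ N → l ∈ full b
  full-complete zero    []                    r len = here refl
  full-complete zero    (cons (s≤s _) () _)   r len
  full-complete (suc b) d r len with Desc-split d
  ... | inj₁ d′ = contradiction (proj₂ (repeated-bounds d′ (r {suc b} (s≤s z≤n) ≤-refl))) 1+n≰n
  ... | inj₂ (l₁ , refl , d₁) with Desc-split d₁
  ...   | inj₁ d′ = contradiction (proj₂ (mem d′)) 1+n≰n
    where
    mem : Desc b l₁ → 1 ≤ suc b × suc b ≤ b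
    mem d′ = All.lookup (Desc-all d′) (mult-∈ {suc b} {l₁}
      (≤-pred (subst (2 ≤_) (mult-same (suc b) l₁) (r {suc b} (s≤s z≤n) ≤-refl))))
  ...   | inj₂ (l₂ , refl , d₂) = ∈-map⁺ (suc b ∷_) (∈-map⁺ (suc b ∷_)
    (block-complete N (full-complete b) d₂
      (λ {i} 1≤i i≤b → repeated-∷⁻ {i} {suc b} {l₂} (neq i≤b)
         (repeated-∷⁻ {i} {suc b} {suc b ∷ l₂} (neq i≤b) (r 1≤i (m≤n⇒m≤1+n i≤b))))
      (≤-trans (≤-trans (n≤1+n _) (n≤1+n _)) len) ≤-refl))
    where
    neq : ∀ {i} → i ≤ b → suc b ≢ i
    neq i≤b refl = 1+n≰n i≤b

  initial-sound : ∀ b → l ∈ initial b → Desc b l × InitialRepeats l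
  initial-sound zero (here refl) = [] , λ _ _ ()
  initial-sound (suc b) l∈ with ∈-++⁻ (initial b) l∈
  ... | inj₁ l∈′ with initial-sound b l∈′
  ...   | d , r = Desc-weaken (n≤1+n b) d , r
  initial-sound {l} (suc b) l∈ | inj₂ l∈′ with ∈-++⁻ (map (suc b ∷_) (initial b)) l∈′
  ... | inj₂ l∈full with full-sound (suc b) l∈full
  ...   | d , r = d , λ {i} {k} 1≤i i<k kk →
                    r 1≤i (≤-trans (<⇒≤ i<k) (proj₂ (repeated-bounds {l = l} {k = k} d kk)))
  initial-sound (suc b) l∈ | inj₂ _ | inj₁ l∈′ with ∈-map⁻ (suc b ∷_) l∈′
  ... | l , l∈″ , refl with initial-sound b l∈″
  ...   | d , r = cons (s≤s z≤n) ≤-refl (Desc-weaken (n≤1+n b) d) , rep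
    where
    rep : InitialRepeats (suc b ∷ l)
    rep {i} {k} 1≤i i<k kk with suc b ≟ k
    ... | no  k≢   = repeated-∷ {i} {l} (suc b) (r 1≤i i<k (repeated-∷⁻ {k} {suc b} {l} k≢ kk))
    ... | yes refl = contradiction (proj₂ (All.lookup (Desc-all d) (mult-∈ {k} {l}
                       (≤-pred (subst (2 ≤_) (mult-same k l) kk))))) 1+n≰n

  initial-complete : ∀ b → Desc b l → InitialRepeats l → length l ≤ N → l ∈ initial b
  initial-complete zero    []                  r len = here refl
  initial-complete zero    (cons (s≤s _) () _) r len
  initial-complete (suc b) d r len with Desc-split d
  ... | inj₁ d′ = ∈-++⁺ˡ (initial-complete b d′ r len)
  ... | inj₂ (l₁ , refl , d₁) with Desc-split d₁
  ...   | inj₁ d′ = ∈-++⁺ʳ (initial b) (∈-++⁺ˡ (∈-map⁺ (suc b ∷_)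
    (initial-complete b d′ r′ (≤-trans (n≤1+n _) len))))
    where
    r′ : InitialRepeats l₁
    r′ {i} {k} 1≤i i<k kk = repeated-∷⁻ {i} {suc b} {l₁}
      (λ { refl → <⇒≱ i<k (≤-trans k≤b (n≤1+n b)) })
      (r 1≤i i<k (repeated-∷ {k} {l₁} (suc b) kk))
      where
      k≤b : k ≤ b
      k≤b = proj₂ (repeated-bounds {l = l₁} {k = k} d′ kk)
  ...   | inj₂ (l₂ , refl , d₂) = ∈-++⁺ʳ (initial b) (∈-++⁺ʳ (map (suc b ∷_) (initial b))
    (full-complete (suc b) d rep len))
    where
    rep : RepeatedUpTo (suc b) (suc b ∷ suc b ∷ l₂)
    rep {i} 1≤i i≤ with i ≟ suc b
    ... | yes refl = repeated-twice i l₂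
    ... | no  i≢   = r {i} {suc b} 1≤i (≤∧≢⇒< i≤ i≢) (repeated-twice (suc b) l₂)

  full-unique : ∀ b → Unique (full b)
  full-unique zero    = [] ∷ []
  full-unique (suc b) = Unique.map⁺ ∷-injectiveʳ (Unique.map⁺ ∷-injectiveʳ
    (block-unique N (proj₁ ∘ full-sound b) (full-unique b)))

  initial-unique : ∀ b → Unique (initial b)
  initial-unique zero    = [] ∷ []
  initial-unique (suc b) = Unique.++⁺ (initial-unique b)
    (Unique.++⁺ (Unique.map⁺ ∷-injectiveʳ (initial-unique b)) (full-unique (suc b)) once-twice) without-with
    where
    once-twice : ∀ {l} → ¬ (l ∈ map (suc b ∷_) (initial b) × l ∈ full (suc b))
    once-twice (p , q) with ∈-map⁻ (suc b ∷_) p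
    ... | l , l∈ , refl with ∈-map⁻ (suc b ∷_) q
    ...   | l′ , l′∈ , eq = map-∷-disjoint (proj₁ ∘ initial-sound b)
      (l∈ , subst (_∈ _) (sym (∷-injectiveʳ eq)) l′∈)
    without-with : ∀ {l} → ¬ (l ∈ initial b × l ∈ map (suc b ∷_) (initial b) ++ full (suc b))
    without-with (p , q) with ∈-++⁻ (map (suc b ∷_) (initial b)) q
    ... | inj₁ q′ = map-∷-disjoint (proj₁ ∘ initial-sound b) (p , q′)
    ... | inj₂ q′ = map-∷-disjoint (proj₁ ∘ initial-sound b) (p , q′)

  open SetoidReasoning setoid

  -- Modulo q^(N+1), `U b` is q^(b(b+1)) / (q;q)_b and `V b` is `U b` divided by 1 + q^(b+1).
  U V G : ℕ → Series
  U b = gf (full b)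
  V b = gf (block N (suc b) (full b))
  G b = gf (initial b)

  U-V : ∀ b → U (suc b) ≈ shift (2 * suc b) (V b)
  U-V b = begin
    U (suc b)
      ≈⟨ mk (λ {n} _ → gf-map-∷ (suc b) (map (suc b ∷_) (block N (suc b) (full b))) n) ⟩
    shift (suc b) (gf (map (suc b ∷_) (block N (suc b) (full b))))
      ≈⟨ shift-cong (suc b) (mk λ {n} _ → gf-map-∷ (suc b) (block N (suc b) (full b)) n) ⟩
    shift (suc b) (shift (suc b) (V b)) ≈⟨ shift-shift (suc b) (suc b) (V b) ⟩
    shift (suc b + suc b) (V b)         ≈⟨ shift-exp (V b) (cong (suc b +_) (sym (+-identityʳ (suc b)))) ⟩
    shift (2 * suc b) (V b)             ∎

  V-unfold : ∀ b → mul1+ (suc b) (V b) ≈ U b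
  V-unfold b = begin
    V b ⊕ shift (suc b) (V b)                       ≈⟨ ⊕-congʳ {shift (suc b) (V b)} expand ⟩
    (U b ⊕ shift (suc b) (V b)) ⊕ shift (suc b) (V b) ≈⟨ ⊕-cancelʳ (U b) (shift (suc b) (V b)) ⟩
    U b                                             ∎
    where
    expand : V b ≈ U b ⊕ shift (suc b) (V b)
    -- Stability allows one more copy of b + 1 in `V b`, and unfolding that larger block once gives
    -- U b + q^(b+1) V b.
    expand = mk λ {n} n≤N → trans (sym (gf-block-stable b (full b) N n≤N))
      (trans (gf-++ (full b) _ n) (cong (U b n xor_) (gf-map-∷ (suc b) (block N (suc b) (full b)) n)))

  U-suc : ∀ b → mul1+ (suc b) (U (suc b)) ≈ shift (2 * suc b) (U b)
  U-suc b = begin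
    mul1+ (suc b) (U (suc b))               ≈⟨ resp (mul1+-linear (suc b)) (U-V b) ⟩
    mul1+ (suc b) (shift (2 * suc b) (V b)) ≈⟨ comm-shift (mul1+-linear (suc b)) (2 * suc b) (V b) ⟩
    shift (2 * suc b) (mul1+ (suc b) (V b)) ≈⟨ shift-cong (2 * suc b) (V-unfold b) ⟩
    shift (2 * suc b) (U b)                 ∎

  U-zero : U 0 ≈ 𝟙
  U-zero = mk λ { {zero} _ → refl ; {suc _} _ → refl }

  U-vanish : U (suc N) ≈ 𝟘
  U-vanish = ≈-trans (U-V N) (shift-large (V N) (m≤m+n (suc N) _))

  open Telescope U U-zero U-suc U-vanish

  G-suc : ∀ b → G (suc b) ≈ mul1+ (suc b) (G b) ⊕ U (suc b)
  G-suc b = begin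
    G (suc b)
      ≈⟨ mk (λ {n} _ → gf-++ (initial b) _ n) ⟩
    G b ⊕ gf (map (suc b ∷_) (initial b) ++ full (suc b))
      ≈⟨ ⊕-congˡ {G b} (mk λ {n} _ → gf-++ (map (suc b ∷_) (initial b)) (full (suc b)) n) ⟩
    G b ⊕ (gf (map (suc b ∷_) (initial b)) ⊕ U (suc b))
      ≈⟨ ⊕-congˡ {G b} (⊕-congʳ {U (suc b)} (mk λ {n} _ → gf-map-∷ (suc b) (initial b) n)) ⟩
    G b ⊕ (shift (suc b) (G b) ⊕ U (suc b))
      ≈⟨ ⊕-assoc (G b) (shift (suc b) (G b)) (U (suc b)) ⟨
    mul1+ (suc b) (G b) ⊕ U (suc b) ∎

  -- Both sides count, mod 2, the partitions with repeated parts 1, ..., v for some v ≤ k: on the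
  -- right, `G k` handles the parts up to k, and the tail adds distinct parts beyond k.
  G-Σ : ∀ k → Σ≤ k (λ v → mulTail v (U v)) ≈ mulTail k (G k)
  G-Σ zero    = ≈-refl
  G-Σ (suc k) = begin
    Σ≤ k (λ v → mulTail v (U v)) ⊕ mulTail (suc k) (U (suc k))
      ≈⟨ ⊕-congʳ {mulTail (suc k) (U (suc k))} (begin
           Σ≤ k (λ v → mulTail v (U v))            ≈⟨ G-Σ k ⟩
           mulTail k (G k)                         ≈⟨ mulTail-unfold k (G k) ⟩
           mul1+ (suc k) (mulTail (suc k) (G k))   ≈⟨ comm-mul1+ lin (suc k) (G k) ⟨
           mulTail (suc k) (mul1+ (suc k) (G k))   ∎) ⟩
    mulTail (suc k) (mul1+ (suc k) (G k)) ⊕ mulTail (suc k) (U (suc k))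
      ≈⟨ add lin (mul1+ (suc k) (G k)) (U (suc k)) ⟨
    mulTail (suc k) (mul1+ (suc k) (G k) ⊕ U (suc k)) ≈⟨ resp lin (G-suc k) ⟨
    mulTail (suc k) (G (suc k))                       ∎
    where lin = mulTail-linear (suc k)

  G≈Y : G N ≈ Y 0
  G≈Y = begin
    -- At k = N the tail has only factors 1 + q^i with i > N.
    G N                          ≈⟨ mulProd-large N (G N) ≤-refl ⟨
    mulTail N (G N)              ≈⟨ G-Σ N ⟨
    Σ≤ N (λ v → mulTail v (U v)) ≈⟨ Σ-cong N (λ v → begin
      mulTail v (U v)                   ≈⟨ mulTail-index (U v) (+-identityʳ v) ⟨
      mulTail (v + 0) (U v)             ≈⟨ shift-exp (mulTail (v + 0) (U v)) (*-zeroʳ v) ⟨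
      shift (v * 0) (mulTail (v + 0) (U v)) ∎) ⟩
    Y 0                          ∎

  -- Each use of `Y-unfold` strips off q^(r+1); after d of them the exponent left is 0, where the
  -- constant 1 gives the coefficient.
  Y-gap : ∀ d r → gap d r ≤ N → Y r (gap d r) ≡ true
  Y-gap zero    r _   = at (Y-unfold r) z≤n
  Y-gap (suc d) r g≤N = trans (at (Y-unfold r) g≤N)
    (trans (shift-at (suc r) (Y (suc r)) (gap d (suc r)))
           (Y-gap d (suc r) (≤-trans (m≤n+m (gap d (suc r)) (suc r)) g≤N)))

  -- The constant 1 in `Y-unfold` is seen only at exponent 0, so a nonzero coefficient at a positive
  -- exponent comes from q^(r+1) Y (r+1). The exponent then drops by r + 1, and m bounds the
  -- recursion.
  Y-gap⁻ : ∀ m r n → n ≤ m → n ≤ N → Y r n ≡ true → ∃[ d ] n ≡ gap d r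
  Y-gap⁻ m       r zero    n≤m n≤N y = 0 , refl
  Y-gap⁻ (suc m) r (suc n) (s≤s n≤m) n≤N y with r ≤? n
  ... | no r≰n = contradiction
    (trans (sym y) (trans (at (Y-unfold r) n≤N) (shift-below (Y (suc r)) (s≤s (≰⇒> r≰n))))) λ ()
  ... | yes r≤n with Y-gap⁻ m (suc r) (n ∸ r) (≤-trans (m∸n≤m n r) n≤m)
                       (≤-trans (m∸n≤m n r) (≤-trans (n≤1+n n) n≤N)) y′
    where
    y′ : Y (suc r) (n ∸ r) ≡ true
    y′ = trans (sym (shift-at (suc r) (Y (suc r)) (n ∸ r)))
      (trans (cong (shift (suc r) (Y (suc r)) ∘ suc) (m+[n∸m]≡n r≤n))
             (trans (sym (at (Y-unfold r) n≤N)) y))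
  ...   | d , eq = suc d , cong suc (trans (sym (m+[n∸m]≡n r≤n)) (cong (r +_) eq))

  -- Parity of `c₁`

  c₁-length : c₁ N ≡ length (filterᵇ (λ l → sum l ≡ᵇ N) (initial N))
  c₁-length = unique-length
    (Unique.filter⁺ (T? ∘ c₁cond) (Unique.filter⁺ (T? ∘ isPartitionOf N) (candidates-unique N)))
    (Unique.filter⁺ (λ l → T? (sum l ≡ᵇ N)) (initial-unique N))
    to-initial from-initial
    where
    to-initial : ∀ {l} → l ∈ filterᵇ c₁cond (partitions N) → l ∈ filterᵇ (λ l → sum l ≡ᵇ N) (initial N)
    to-initial {l} l∈ with ∈-filter⁻ (T? ∘ c₁cond) {xs = partitions N} l∈
    ... | l∈p , c with isPartitionOf-Desc l (proj₂ (∈-filter⁻ (T? ∘ isPartitionOf N) {xs = candidates N} l∈p))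
    ...   | d , s = ∈-filter⁺ (λ l → T? (sum l ≡ᵇ N))
      -- A partition of N has at most N parts, so the multiplicity cap of the enumeration excludes
      -- none of them.
      (initial-complete N d (c₁cond⇒initial l c) (≤-trans (Desc-length d) (≤-reflexive s)))
      (≡⇒≡ᵇ (sum l) N s)
    from-initial : ∀ {l} → l ∈ filterᵇ (λ l → sum l ≡ᵇ N) (initial N) → l ∈ filterᵇ c₁cond (partitions N)
    from-initial {l} l∈ with ∈-filter⁻ (λ l → T? (sum l ≡ᵇ N)) {xs = initial N} l∈
    ... | l∈i , s with initial-sound N l∈i | ≡ᵇ⇒≡ (sum l) N s
    ...   | d , r | s≡ = ∈-filter⁺ (T? ∘ c₁cond)
      (∈-filter⁺ (T? ∘ isPartitionOf N) (Desc-candidate d s≡) (Desc-isPartitionOf d s≡))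
      (initial⇒c₁cond d r)

  odd-c₁ : odd (c₁ N) ≡ Y 0 N
  odd-c₁ = trans (cong odd c₁-length) (trans (odd-length-gf (initial N) N) (at G≈Y ≤-refl))

  c₁-tri : (c₁ N % 2 ≡ 1) ⇔ (∃[ j ] N ≡ (j * suc j) / 2)
  c₁-tri = mk⇔ fwd bwd
    where
    fwd : c₁ N % 2 ≡ 1 → ∃[ j ] N ≡ (j * suc j) / 2
    fwd p with Y-gap⁻ N 0 N ≤-refl ≤-refl (trans (sym odd-c₁) (to (odd-%2 (c₁ N)) p))
    ... | d , eq = d , trans eq (gap-zero d)
    bwd : ∃[ j ] N ≡ (j * suc j) / 2 → c₁ N % 2 ≡ 1
    bwd (j , eq) = from (odd-%2 (c₁ N)) (trans odd-c₁
      (trans (cong (Y 0) N≡) (Y-gap j 0 (≤-reflexive (sym N≡)))))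
      where N≡ = trans eq (sym (gap-zero j))

theorem1 : (n : ℕ) → (c₁ n % 2 ≡ 1) ⇔ (∃[ j ] n ≡ (j * suc j) / 2)
theorem1 n = Enumeration.c₁-tri n
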